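{- Let $\mathbf{K}$ be a class of finite lattices which is a variety or a quasi-variety. If $\mathcal{P}\in\mathbf{K}$, then $\mathcal{P}^{[m]}\in\mathbf{K}$ for every integer $m>0$, where $\mathcal{P}^{[m]}$ is the poset of $m$-multichains of $\mathcal{P}$.
   Context: For a finite poset $\mathcal{P}=(P,\leq)$ and an integer $m>0$, let $P^{[m]}=\{(x_1,\ldots,x_m)\in P^m\mid x_1\leq x_2\leq\cdots\leq x_m\}$ be the set of $m$-multichains. The poset of $m$-multichains is $\mathcal{P}^{[m]}=(P^{[m]},\leq)$ with the componentwise order: $(x_1,\ldots,x_m)\leq(y_1,\ldots,y_m)$ if and only if $x_i\leq y_i$ for all $i\in\{1,\ldots,m\}$. A lattice is a poset in which every two elements have a meet (greatest lower bound) $\wedge$ and a join (least upper bound) $\vee$. Lattice terms are the formal expressions built recursively from variables using finite meets $(t_1\wedge\cdots\wedge t_s)$ and finite joins $(t_1\vee\cdots\vee t_s)$. A quasi-identity is an implication of the form "$s_1=t_1$ and $s_2=t_2$ and $\ldots$ and $s_n=t_n$ imply $s=t$", where $n\geq 0$ and $s_1,\ldots,s_n,t_1,\ldots,t_n,s,t$ are lattice terms; if $n=0$ it is called an identity. A lattice satisfies a (quasi-)identity if it holds for all assignments of lattice elements to the variables. A class $\mathbf{K}$ of finite lattices is a variety (respectively, quasi-variety) if there is a set $\Sigma$ of identities (respectively, quasi-identities) such that $\mathbf{K}$ consists exactly of the finite lattices satisfying all members of $\Sigma$. -}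

module Defs where

open import Data.Fin.Base using (Fin)
open import Data.List.Base using (List; []; _∷_)
open import Data.List.NonEmpty.Base using (List⁺; _∷_)
open import Data.List.Relation.Unary.All using (All)
open import Data.Nat.Base using (ℕ)
open import Data.Product.Base using (Σ-syntax; ∃-syntax; _×_; proj₁)
open import Data.Vec.Base using (Vec)
open import Data.Vec.Relation.Binary.Pointwise.Inductive as Pointwise using (Pointwise; []; _∷_)
open import Data.Vec.Relation.Unary.Linked using (Linked)
open import Function.Bundles using (Inverse; _⇔_)
open import Level using (Level; _⊔_) renaming (suc to lsuc)
open import Relation.Binary.Bundles using (Poset)
import Relation.Binary.Construct.On as On
open import Relation.Binary.Definitions using (Antisymmetric)
open import Relation.Binary.Lattice.Bundles using (Lattice)
open import Relation.Binary.Lattice.Structures using (IsLattice)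
open import Relation.Binary.PropositionalEquality.Core using (_≡_)
import Relation.Binary.PropositionalEquality.Properties as ≡
open import Relation.Unary using (Pred; _∈_)

private
  variable
    ℓ κ : Level

-- Cardinality is counted up to the equality _≈_ of the poset.
IsFinite : Poset ℓ ℓ ℓ → Set ℓ
IsFinite P = ∃[ n ] Inverse (≡.setoid (Fin n)) (Poset.Eq.setoid P)

-- Meets and joins are determined up to _≈_ by the order, so this is a property
-- of the poset rather than additional structure.
record HasLatticeStructure (P : Poset ℓ ℓ ℓ) : Set ℓ where
  open Poset P using (Carrier; _≈_; _≤_)
  field
    _∨_       : Carrier → Carrier → Carrier
    _∧_       : Carrier → Carrier → Carrier
    isLattice : IsLattice _≈_ _≤_ _∨_ _∧_

  lattice : Lattice ℓ ℓ ℓ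
  lattice = record { isLattice = isLattice }

module _ (P : Poset ℓ ℓ ℓ) (m : ℕ) where
  open Poset P using (Carrier; _≈_; _≤_; isEquivalence; reflexive; trans; antisym)

  Multichain : Set ℓ
  Multichain = Σ[ xs ∈ Vec Carrier m ] Linked _≤_ xs

  private
    pointwise-reflexive : ∀ {n k} {xs : Vec Carrier n} {ys : Vec Carrier k} →
                          Pointwise _≈_ xs ys → Pointwise _≤_ xs ys
    pointwise-reflexive = Pointwise.map reflexive

    pointwise-antisym : ∀ {n} → Antisymmetric (Pointwise _≈_ {n} {n}) (Pointwise _≤_)
    pointwise-antisym []       []       = []
    pointwise-antisym (p ∷ ps) (q ∷ qs) = antisym p q ∷ pointwise-antisym ps qs

    componentwise : Poset ℓ ℓ ℓ
    componentwise = record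
      { Carrier        = Vec Carrier m
      ; _≈_            = Pointwise _≈_
      ; _≤_            = Pointwise _≤_
      ; isPartialOrder = record
        { isPreorder = record
          { isEquivalence = Pointwise.isEquivalence isEquivalence m
          ; reflexive     = pointwise-reflexive
          ; trans         = Pointwise.trans trans
          }
        ; antisym    = pointwise-antisym
        }
      }

  multichainPoset : Poset ℓ ℓ ℓ
  multichainPoset = On.poset {B = Multichain} componentwise proj₁

infix 8 _^[_]
_^[_] : Poset ℓ ℓ ℓ → ℕ → Poset ℓ ℓ ℓ
P ^[ m ] = multichainPoset P m

-- Finite meets and joins have at least one argument: the empty ones would
-- denote a top and a bottom element, which are not part of the signature.
data Term : Set where
  var : ℕ → Term
  ⋀ ⋁ : List⁺ Term → Term

infix 4 _≐_
record Equation : Set where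
  constructor _≐_
  field
    lhs rhs : Term

infix 3 _⇛_
record QuasiIdentity : Set where
  constructor _⇛_
  field
    premises   : List Equation
    conclusion : Equation

IsIdentity : QuasiIdentity → Set
IsIdentity q = QuasiIdentity.premises q ≡ []

module _ (L : Lattice ℓ ℓ ℓ) where
  open Lattice L using (Carrier; _≈_; _∨_; _∧_)

  Assignment : Set ℓ
  Assignment = ℕ → Carrier

  module _ (ρ : Assignment) where
    ⟦_⟧ : Term → Carrier
    meetOf joinOf : Term → List Term → Carrier

    ⟦ var i ⟧      = ρ i
    ⟦ ⋀ (t ∷ ts) ⟧ = meetOf t ts
    ⟦ ⋁ (t ∷ ts) ⟧ = joinOf t ts

    meetOf t []       = ⟦ t ⟧
    meetOf t (u ∷ us) = ⟦ t ⟧ ∧ meetOf u us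

    joinOf t []       = ⟦ t ⟧
    joinOf t (u ∷ us) = ⟦ t ⟧ ∨ joinOf u us

    HoldsAt : Equation → Set ℓ
    HoldsAt (s ≐ t) = ⟦ s ⟧ ≈ ⟦ t ⟧

  Satisfies : QuasiIdentity → Set ℓ
  Satisfies (es ⇛ e) = ∀ ρ → All (HoldsAt ρ) es → HoldsAt ρ e

IsFiniteModel : ∀ {σ} → Pred QuasiIdentity σ → Poset ℓ ℓ ℓ → Set (ℓ ⊔ σ)
IsFiniteModel S P =
  IsFinite P ×
  (Σ[ L ∈ HasLatticeStructure P ]
    (∀ q → q ∈ S → Satisfies (HasLatticeStructure.lattice L) q))

IsQuasiVariety : (σ : Level) → Pred (Poset ℓ ℓ ℓ) κ → Set (lsuc ℓ ⊔ κ ⊔ lsuc σ)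
IsQuasiVariety σ K =
  Σ[ S ∈ Pred QuasiIdentity σ ] (∀ P → P ∈ K ⇔ IsFiniteModel S P)

IsVariety : (σ : Level) → Pred (Poset ℓ ℓ ℓ) κ → Set (lsuc ℓ ⊔ κ ⊔ lsuc σ)
IsVariety σ K =
  Σ[ S ∈ Pred QuasiIdentity σ ]
    (∀ q → q ∈ S → IsIdentity q) × (∀ P → P ∈ K ⇔ IsFiniteModel S P)

{-# OPTIONS --safe #-}

-- Running joins (x₁ , x₁ ∨ x₂ , x₁ ∨ x₂ ∨ x₃ , …) retract the finite power P ^ m
-- onto the m-multichains, so P ^[ m ] is finite.  Multichains are closed under
-- coordinatewise ∨ and ∧, so P ^[ m ] is a lattice whose i-th coordinate map
-- commutes with every term; a quasi-identity can therefore be checked in P one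
-- coordinate at a time.
module Submission where

open import Defs
open import Data.Fin.Base using (Fin; zero; suc; finToFun; funToFin)
open import Data.Fin.Properties using (finToFun-funToFin) renaming (_≟_ to _≟ᶠ_)
import Data.List.Base as List
open import Data.List.Base using ([]; _∷_; deduplicate)
open import Data.List.Membership.Setoid.Properties using (∈-lookup)
open import Data.List.NonEmpty.Base using (_∷_)
open import Data.List.Relation.Unary.All as All using (All)
open import Data.List.Relation.Unary.AllPairs using (_∷_)
import Data.List.Relation.Unary.Any.Properties as Any
import Data.List.Relation.Unary.Enumerates.Setoid as Enumerates
import Data.List.Relation.Unary.Enumerates.Setoid.Properties as Enumeratesₚ
import Data.List.Relation.Unary.Unique.Setoid as Unique
import Data.List.Relation.Unary.Unique.DecSetoid.Properties as Uniqueₚ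
open import Data.Nat.Base using (ℕ; _>_; _^_)
open import Data.Product.Base using (∃-syntax; _,_; proj₁)
open import Data.Sum.Base using (_⊎_; inj₁; inj₂)
open import Data.Vec.Base using (Vec; []; _∷_; lookup; tabulate; zipWith)
open import Data.Vec.Properties using (lookup-zipWith; tabulate∘lookup)
import Data.Vec.Relation.Binary.Pointwise.Extensional as Extensional
open import Data.Vec.Relation.Binary.Pointwise.Inductive as Pointwise using (Pointwise; []; _∷_)
open import Data.Vec.Relation.Unary.Linked using (Linked; []; [-]; _∷_)
open import Function.Base using (_∘_)
open import Function.Bundles using (Equivalence; Inverse)
open import Function.Properties.Bijection using (Bijection⇒Inverse)
open import Level using (Level)
open import Relation.Binary.Bundles using (DecSetoid; Poset; Setoid)
import Relation.Binary.Construct.On as On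
open import Relation.Binary.Core using (REL; Rel; _Preserves₂_⟶_⟶_)
open import Relation.Binary.Definitions using (Decidable)
open import Relation.Binary.Lattice.Bundles using (Lattice)
import Relation.Binary.Lattice.Properties.JoinSemilattice as Joinₚ
import Relation.Binary.Lattice.Properties.MeetSemilattice as Meetₚ
open import Relation.Binary.PropositionalEquality
  using (_≡_; refl; sym; trans; cong; cong₂; subst; subst₂; setoid)
open import Relation.Nullary.Decidable using (map′)
open import Relation.Nullary.Negation using (contradiction)
open import Relation.Unary using (Pred; _∈_)

private
  variable
    a b ℓ r : Level
    A : Set a
    B : Set b
    n : ℕ

module _ (S : Setoid a ℓ) where
  open Setoid S using (_≈_; _≉_) renaming (sym to ≈-sym; trans to ≈-trans)
  open Unique S using (Unique)

  private
    lookup-≉ : ∀ {x ys} → All (x ≉_) ys → ∀ i → x ≉ List.lookup ys i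
    lookup-≉ x∉ys i = All.lookupₛ S (λ y≈z x≉y x≈z → x≉y (≈-trans x≈z (≈-sym y≈z)))
                                  x∉ys (∈-lookup S _ i)

  lookup-injective : ∀ {xs} → Unique xs → ∀ i j → List.lookup xs i ≈ List.lookup xs j → i ≡ j
  lookup-injective (_    ∷ _)   zero    zero    _  = refl
  lookup-injective (x∉xs ∷ _)   zero    (suc j) eq = contradiction eq (lookup-≉ x∉xs j)
  lookup-injective (x∉xs ∷ _)   (suc i) zero    eq = contradiction (≈-sym eq) (lookup-≉ x∉xs i)
  lookup-injective (_    ∷ xs!) (suc i) (suc j) eq = cong suc (lookup-injective xs! i j eq)

module _ (S : DecSetoid a ℓ) where
  open DecSetoid S using (Carrier; _≈_; _≟_) renaming (setoid to S′; sym to ≈-sym)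
  open Enumerates S′ using (IsEnumeration)

  -- Deduplicating with the decidable equality makes `List.lookup` injective, and the shortened list
  -- still covers the carrier, so indexing into it is a bijection.
  enumeration⇒finite : ∀ {xs} → IsEnumeration xs → ∃[ k ] Inverse (setoid (Fin k)) S′
  enumeration⇒finite {xs} enum = List.length ys , Bijection⇒Inverse (record
    { to        = List.lookup ys
    ; cong      = λ { refl → DecSetoid.refl S }
    ; bijective = (λ {i} {j} → lookup-injective S′ (Uniqueₚ.deduplicate-! S xs) i j)
                , Enumeratesₚ.lookup-surjective S′ (Enumeratesₚ.deduplicate⁺ S enum)
    })
    where ys = deduplicate _≟_ xs

  -- `IsFinite` asks for a bijection, but distinct vectors can have the same running joins; covering
  -- every element is all that the coding of multichains provides directly.
  surjection⇒finite : (f : Fin n → Carrier) → (∀ x → ∃[ i ] f i ≈ x) →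
                      ∃[ k ] Inverse (setoid (Fin k)) S′
  surjection⇒finite f surj = enumeration⇒finite {List.tabulate f} λ x →
    let (i , fi≈x) = surj x in Any.tabulate⁺ i (≈-sym fi≈x)

-- Equality is pulled back from `Fin` along the bijection; deduplication of the multichains relies
-- on it.
finite⇒decidable : (P : Poset ℓ ℓ ℓ) → IsFinite P → Decidable (Poset._≈_ P)
finite⇒decidable P (_ , inv) x y =
  map′ (λ eq → P.Eq.trans (P.Eq.sym (strictlyInverseˡ x)) (P.Eq.trans (to-cong eq) (strictlyInverseˡ y)))
       from-cong (from x ≟ᶠ from y)
  where
  open Inverse inv
  module P = Poset P

pointwise : {R : REL A B r} {xs : Vec A n} {ys : Vec B n} →
            (∀ i → R (lookup xs i) (lookup ys i)) → Pointwise R xs ys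
pointwise = Extensional.extensional⇒inductive ∘ Extensional.ext

zipWith-linked : {R : Rel A r} {f : A → A → A} → f Preserves₂ R ⟶ R ⟶ R →
                 {xs ys : Vec A n} → Linked R xs → Linked R ys → Linked R (zipWith f xs ys)
zipWith-linked f-mono [] [] = []
zipWith-linked f-mono [-] [-] = [-]
-- Splitting both tails exposes their heads, so that the head of the zipped tail computes.
zipWith-linked f-mono (_∷_ {xs = _ ∷ _} p ps) (_∷_ {xs = _ ∷ _} q qs) =
  f-mono p q ∷ zipWith-linked f-mono ps qs

module _ (P : Poset ℓ ℓ ℓ) (H : HasLatticeStructure P) (m : ℕ) where
  open HasLatticeStructure H using (lattice)
  open Lattice lattice
    using (Carrier; _≈_; _≤_; _∨_; _∧_; joinSemilattice; meetSemilattice;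
           x≤x∨y; y≤x∨y; ∨-least; x∧y≤x; x∧y≤y; ∧-greatest)
  open Poset P using (module Eq)
  open Joinₚ joinSemilattice using (∨-monotonic; ∨-cong; x≤y⇒x∨y≈y)
  open Meetₚ meetSemilattice using (∧-monotonic)

  private
    module M = Poset (P ^[ m ])

  -- The accumulator `x` is the join of the entries already read and is not emitted again.
  -- `runningJoins` seeds it with the first entry, since there is no bottom element in the signature
  -- to start from.
  joinFrom : Carrier → Vec Carrier n → Vec Carrier n
  joinFrom x []       = []
  joinFrom x (y ∷ ys) = x ∨ y ∷ joinFrom (x ∨ y) ys

  runningJoins : Vec Carrier n → Vec Carrier n
  runningJoins []       = []
  runningJoins (x ∷ xs) = x ∷ joinFrom x xs

  joinFrom-linked : ∀ x (ys : Vec Carrier n) → Linked _≤_ (x ∷ joinFrom x ys)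
  joinFrom-linked x []       = [-]
  joinFrom-linked x (y ∷ ys) = x≤x∨y x y ∷ joinFrom-linked (x ∨ y) ys

  runningJoins-linked : (xs : Vec Carrier n) → Linked _≤_ (runningJoins xs)
  runningJoins-linked []       = []
  runningJoins-linked (x ∷ xs) = joinFrom-linked x xs

  -- Along a chain each join collapses to its larger argument. Both accumulator and entries are
  -- allowed to vary up to `_≈_`, because decoding from `Fin` recovers an element only up to `_≈_`.
  joinFrom-chain : ∀ {x y} {xs ys : Vec Carrier n} → x ≈ y → Pointwise _≈_ xs ys →
                   Linked _≤_ (y ∷ ys) → Pointwise _≈_ (joinFrom x xs) ys
  joinFrom-chain x≈y []             _            = []
  joinFrom-chain x≈y (x′≈y′ ∷ xs≈ys) (y≤y′ ∷ ys↗) =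
    x∨x′≈y′ ∷ joinFrom-chain x∨x′≈y′ xs≈ys ys↗
    where x∨x′≈y′ = Eq.trans (∨-cong x≈y x′≈y′) (x≤y⇒x∨y≈y y≤y′)

  runningJoins-chain : {xs ys : Vec Carrier n} → Pointwise _≈_ xs ys →
                       Linked _≤_ ys → Pointwise _≈_ (runningJoins xs) ys
  runningJoins-chain []            _   = []
  runningJoins-chain (x≈y ∷ xs≈ys) ys↗ = x≈y ∷ joinFrom-chain x≈y xs≈ys ys↗

  multichains-finite : IsFinite P → IsFinite (P ^[ m ])
  multichains-finite fin@(k , inv) = surjection⇒finite multichains≟ chain surj
    where
    open Inverse inv using (to; from; strictlyInverseˡ)

    multichains≟ : DecSetoid ℓ ℓ
    multichains≟ = On.decSetoid
      (Pointwise.decSetoid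
        (record { isDecEquivalence = record
          { isEquivalence = Eq.isEquivalence ; _≟_ = finite⇒decidable P fin } }) m)
      proj₁

    chain : Fin (k ^ m) → Multichain P m
    chain i = runningJoins xs , runningJoins-linked xs
      -- A number below `k ^ m` codes a function from `Fin m` to `Fin k`, hence an arbitrary vector
      -- over `P`; running joins then force it to be a chain.
      where xs = tabulate (to ∘ finToFun i)

    surj : ∀ c → ∃[ i ] chain i M.≈ c
    surj (xs , xs↗) = funToFin code , runningJoins-chain xs′≈xs xs↗
      where
      code = λ i → from (lookup xs i)

      xs′≈xs : Pointwise _≈_ (tabulate (to ∘ finToFun (funToFin code))) xs
      -- Rewriting `xs` as the tabulation of its own entries reduces the round trip through the code
      -- to one entry at a time.
      xs′≈xs = subst (Pointwise _≈_ _) (tabulate∘lookup xs)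
        (Pointwise.tabulate⁺ λ i →
          Eq.trans (Eq.reflexive (cong to (finToFun-funToFin code i)))
                   (strictlyInverseˡ (lookup xs i)))

  multichainLattice : HasLatticeStructure (P ^[ m ])
  multichainLattice = record
    { _∨_       = λ (xs , xs↗) (ys , ys↗) → zipWith _∨_ xs ys , zipWith-linked ∨-monotonic xs↗ ys↗
    ; _∧_       = λ (xs , xs↗) (ys , ys↗) → zipWith _∧_ xs ys , zipWith-linked ∧-monotonic xs↗ ys↗
    ; isLattice = record
      { isPartialOrder = M.isPartialOrder
      ; supremum = λ (xs , _) (ys , _) →
            -- The order is componentwise, so each bound is checked at index `i`, where
            -- `lookup-zipWith` turns the zipped vector into a join or meet in `P`.
            pointwise (λ i → subst (_ ≤_) (sym (lookup-zipWith _∨_ i xs ys)) (x≤x∨y _ _))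
          , pointwise (λ i → subst (_ ≤_) (sym (lookup-zipWith _∨_ i xs ys)) (y≤x∨y _ _))
          , λ _ xs≤zs ys≤zs → pointwise λ i →
              subst (_≤ _) (sym (lookup-zipWith _∨_ i xs ys))
                (∨-least (Pointwise.lookup xs≤zs i) (Pointwise.lookup ys≤zs i))
      ; infimum = λ (xs , _) (ys , _) →
            pointwise (λ i → subst (_≤ _) (sym (lookup-zipWith _∧_ i xs ys)) (x∧y≤x _ _))
          , pointwise (λ i → subst (_≤ _) (sym (lookup-zipWith _∧_ i xs ys)) (x∧y≤y _ _))
          , λ _ zs≤xs zs≤ys → pointwise λ i →
              subst (_ ≤_) (sym (lookup-zipWith _∧_ i xs ys))
                (∧-greatest (Pointwise.lookup zs≤xs i) (Pointwise.lookup zs≤ys i))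
      }
    }

  private
    L^m = HasLatticeStructure.lattice multichainLattice

  coordinate : Fin m → Multichain P m → Carrier
  coordinate i (xs , _) = lookup xs i

  module _ (ρ : Assignment L^m) (i : Fin m) where
    private
      ρᵢ = coordinate i ∘ ρ

    -- Each coordinate map is a lattice homomorphism, and holds strictly, not just up to `_≈_`,
    -- because `lookup` commutes with `zipWith` propositionally. The three mutual proofs follow the
    -- recursion of the evaluation.
    coordinate-⟦⟧ : ∀ t → coordinate i (⟦_⟧ L^m ρ t) ≡ ⟦_⟧ lattice ρᵢ t
    coordinate-meetOf : ∀ t ts → coordinate i (meetOf L^m ρ t ts) ≡ meetOf lattice ρᵢ t ts
    coordinate-joinOf : ∀ t ts → coordinate i (joinOf L^m ρ t ts) ≡ joinOf lattice ρᵢ t ts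

    coordinate-⟦⟧ (var j)      = refl
    coordinate-⟦⟧ (⋀ (t ∷ ts)) = coordinate-meetOf t ts
    coordinate-⟦⟧ (⋁ (t ∷ ts)) = coordinate-joinOf t ts

    coordinate-meetOf t []       = coordinate-⟦⟧ t
    coordinate-meetOf t (u ∷ us) =
      trans (lookup-zipWith _∧_ i (proj₁ (⟦_⟧ L^m ρ t)) (proj₁ (meetOf L^m ρ u us)))
            (cong₂ _∧_ (coordinate-⟦⟧ t) (coordinate-meetOf u us))

    coordinate-joinOf t []       = coordinate-⟦⟧ t
    coordinate-joinOf t (u ∷ us) =
      trans (lookup-zipWith _∨_ i (proj₁ (⟦_⟧ L^m ρ t)) (proj₁ (joinOf L^m ρ u us)))
            (cong₂ _∨_ (coordinate-⟦⟧ t) (coordinate-joinOf u us))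

    holdsAt-coordinate : ∀ e → HoldsAt L^m ρ e → HoldsAt lattice ρᵢ e
    holdsAt-coordinate (s ≐ t) s≈t =
      subst₂ _≈_ (coordinate-⟦⟧ s) (coordinate-⟦⟧ t) (Pointwise.lookup s≈t i)

  holdsAt-coordinatewise : ∀ ρ e → (∀ i → HoldsAt lattice (coordinate i ∘ ρ) e) → HoldsAt L^m ρ e
  holdsAt-coordinatewise ρ (s ≐ t) s≈t = pointwise λ i →
    subst₂ _≈_ (sym (coordinate-⟦⟧ ρ i s)) (sym (coordinate-⟦⟧ ρ i t)) (s≈t i)

  multichains-satisfy : ∀ q → Satisfies lattice q → Satisfies L^m q
  multichains-satisfy (es ⇛ e) sat ρ premises = holdsAt-coordinatewise ρ e λ i →
    -- Premises descend to coordinate `i`, where the quasi-identity is known in `P`; the conclusions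
    -- at all `i` together give the one for multichains.
    sat (coordinate i ∘ ρ) (All.map (λ {e′} → holdsAt-coordinate ρ i e′) premises)

multichains-model : ∀ {σ} (S : Pred QuasiIdentity σ) (P : Poset ℓ ℓ ℓ) (m : ℕ) →
                    IsFiniteModel S P → IsFiniteModel S (P ^[ m ])
multichains-model S P m (fin , H , sat) =
  multichains-finite P H m fin , multichainLattice P H m ,
  λ q q∈S → multichains-satisfy P H m q (sat q q∈S)

theorem2p20 : {ℓ κ σ : Level} (K : Pred (Poset ℓ ℓ ℓ) κ) →
    IsVariety σ K ⊎ IsQuasiVariety σ K →
    (P : Poset ℓ ℓ ℓ) → P ∈ K →
    (m : ℕ) → m > 0 → P ^[ m ] ∈ K
-- Identities are quasi-identities with no premises, so the same set `S` presents a variety as a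
-- quasi-variety.
theorem2p20 K (inj₁ (S , _ , K⇔)) P P∈K m m>0 = theorem2p20 K (inj₂ (S , K⇔)) P P∈K m m>0
theorem2p20 K (inj₂ (S , K⇔)) P P∈K m _ =
  Equivalence.from (K⇔ (P ^[ m ])) (multichains-model S P m (Equivalence.to (K⇔ P) P∈K))
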